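{- Let $d\ge 2$ be an integer. Let $H$ be a connected graph with maximum degree $d$ and $N$ vertices, where $N>d^{d^{d^d}}$. Then there exists a graph $G$ such that $N\le |V(G)|\le 2^{d^{21d+20}}N$, the maximum degree of $G$ is at most $d\,2^{d^{21d+20}}$, and there are at least $2^{|V(G)|/2^{d^{21d+20}}}$ sets $S\subseteq V(G)$ such that $G[S]$ is a maximal blow-up of $H$.
   Context: All graphs are finite and simple. With $V(H)=\{1,\dots,k\}$, a blow-up of $H$ is a graph whose vertex set is partitioned into nonempty sets $V_1\sqcup\dots\sqcup V_k$ such that $V_i$ is complete to $V_j$ whenever $ij\in E(H)$ (no other conditions; edges inside parts and between parts of non-adjacent vertices are allowed). For $S\subseteq V(G)$, $G[S]$ is a maximal blow-up of $H$ if $G[S]$ is a blow-up of $H$ and there is no $S'$ with $S\subsetneq S'\subseteq V(G)$ such that $G[S']$ is a blow-up of $H$. -}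

module Defs where

open import Data.Bool using (Bool; true; false; if_then_else_)
open import Data.Nat using (ℕ; _+_; _*_; _^_; _≤_; _<_)
open import Data.Fin using (Fin)
open import Data.Fin.Subset using (Subset; _∈_; _⊂_)
open import Data.List using (List; map; length; allFin)
open import Data.Nat.ListAction using (sum)
open import Data.List.Relation.Unary.All using (All)
open import Data.List.Relation.Unary.Unique.Propositional using (Unique)
open import Data.Product using (Σ; ∃; _×_)
open import Relation.Binary.PropositionalEquality using (_≡_)
open import Relation.Nullary using (¬_)

record Graph (n : ℕ) : Set where
  field
    adj   : Fin n → Fin n → Bool
    sym   : ∀ u v → adj u v ≡ adj v u
    irrefl : ∀ v → adj v v ≡ false
open Graph public

deg : ∀ {n} → Graph n → Fin n → ℕ
deg {n} G v = sum (map (λ u → if adj G v u then 1 else 0) (allFin n))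

MaxDegree : ∀ {n} → Graph n → ℕ → Set
MaxDegree {n} G d = (∀ v → deg G v ≤ d) × (∃ λ v → deg G v ≡ d)

data Reachable {n} (G : Graph n) : Fin n → Fin n → Set where
  here : ∀ {v} → Reachable G v v
  step : ∀ {u w v} → adj G u w ≡ true → Reachable G w v → Reachable G u v

Connected : ∀ {n} → Graph n → Set
Connected {n} G = ∀ (u v : Fin n) → Reachable G u v

-- G[S] is a blow-up of H: a map f assigning each vertex of S to a part V_i = f⁻¹(i) ∩ S,
-- all parts nonempty, and V_i complete to V_j whenever ij ∈ E(H).
IsBlowup : ∀ {k n} → Graph k → Graph n → Subset n → Set
IsBlowup {k} {n} H G S =
  Σ (Fin n → Fin k) λ f →
    (∀ (i : Fin k) → ∃ λ v → v ∈ S × f v ≡ i) ×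
    (∀ (u v : Fin n) → u ∈ S → v ∈ S → adj H (f u) (f v) ≡ true → adj G u v ≡ true)

IsMaximalBlowup : ∀ {k n} → Graph k → Graph n → Subset n → Set
IsMaximalBlowup {k} {n} H G S =
  IsBlowup H G S × (∀ (S' : Subset n) → S ⊂ S' → ¬ IsBlowup H G S')

AtLeastMaxBlowups : ∀ {k n} → Graph k → Graph n → ℕ → Set
AtLeastMaxBlowups {k} {n} H G c =
  Σ (List (Subset n)) λ L → Unique L × All (IsMaximalBlowup H G) L × c ≤ length L

-- "the number of such sets is ≥ 2^(n / M)" (real exponent), encoded exactly as:
-- there are c such sets with c ^ M ≥ 2 ^ n.
ManyMaxBlowups : ∀ {k n} → Graph k → Graph n → ℕ → Set
ManyMaxBlowups {k} {n} H G M = ∃ λ c → AtLeastMaxBlowups H G c × 2 ^ n ≤ c ^ M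

{-# OPTIONS --safe #-}
module Submission where

-- Let K = 2^(d^(21d+20)) and choose centres in H, maximal subject to having pairwise disjoint closed
-- neighbourhoods; there are m ≥ N/(d+1)² of them.  Take G on V(H) × Fin K, where (u , a) ~ (v , b) iff
-- uv ∈ E(H) and (a = b or neither u nor v is a centre).  A label A i ∈ Fin K for every centre c i gives
-- a copy of H in G: use layer A i on the closed neighbourhood of c i, and any layer elsewhere.
-- Conversely a blow-up S' meets the fibres of the centres in at most N vertices: each of these
-- is adjacent to a representative of some part of S', and a vertex of G has at most one neighbour over
-- the centres.  If s_i of them lie over c i, then S' contains at most ∏ s_i ≤ 2^(∑ s_i) ≤ 2^N of the
-- K^m ≥ 2^N · 2^N copies, so there are at least 2^N maximal blow-ups.

open import Defs
open import Data.Nat using (ℕ; _+_; _*_; _^_; _≤_; _<_)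
open import Data.Product using (Σ; ∃; _×_)

open import Data.Nat using (zero; suc; z≤n; s≤s)
open import Data.Nat.Properties hiding (_≟_)
open import Algebra.Properties.CommutativeSemigroup +-commutativeSemigroup
  using (interchange; x∙yz≈y∙xz)
open import Data.Nat.ListAction using (sum; product)
open import Data.Bool using (Bool; true; false; if_then_else_; _∧_; _∨_; not)
import Data.Bool.Properties as Bool
open import Data.Fin using (Fin; zero; suc; combine; remQuot; finToFun; funToFin; fromℕ<; punchIn)
open import Data.Fin.Properties
  using (_≟_; any?; all?; injective⇒≤; remQuot-combine; combine-remQuot; finToFun-funToFin;
         punchInᵢ≢i)
open import Data.Fin.Subset using (Subset; _∈_; _⊆_; _⊃_)
open import Data.Fin.Subset.Properties using (_∈?_; _⊂?_; ⊆-refl; ⊆-trans; anySubset?)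
open import Data.Fin.Subset.Induction using (⊃-wellFounded)
open import Data.List
  using (List; []; _∷_; map; length; allFin; filter; concat; concatMap; tabulate; lookup; _++_)
open import Data.List.Properties using (length-++; length-map; length-tabulate; tabulate-cong)
open import Data.List.Membership.Propositional using () renaming (_∈_ to _∈ˡ_)
open import Data.List.Membership.Propositional.Properties
  using (∈-lookup; ∈-filter⁺; ∈-filter⁻; ∈-allFin; ∈-map⁺; ∈-map⁻; ∈-concatMap⁺)
import Data.List.Membership.DecPropositional as DecMembership
import Data.List.Relation.Binary.Subset.Propositional as List
open import Data.List.Relation.Unary.All as All using (All; []; _∷_)
open import Data.List.Relation.Unary.All.Properties using (¬Any⇒All¬)
  renaming (tabulate⁺ to All-tabulate⁺)
open import Data.List.Relation.Unary.AllPairs using (AllPairs; []; _∷_)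
import Data.List.Relation.Unary.AllPairs.Properties as AllPairs
open import Data.List.Relation.Unary.Any as Any using (Any; here; there; index)
open import Data.List.Relation.Unary.Any.Properties using (lookup-index; concat⁻)
  renaming (tabulate⁻ to Any-tabulate⁻)
open import Data.List.Relation.Unary.Unique.Propositional using (Unique)
import Data.List.Relation.Unary.Unique.Propositional.Properties as Unique
import Data.Vec as Vec
open import Data.Vec.Properties using (lookup∘tabulate; []=⇒lookup; lookup⇒[]=)
open import Data.Product using (_,_; proj₁; proj₂)
open import Function using (_∘_; id; mk⇔)
open import Induction.WellFounded using (Acc; acc)
open import Relation.Binary.PropositionalEquality as ≡
  using (_≡_; refl; trans; cong; cong₂; subst; subst₂)
open import Relation.Nullary using (¬_; Dec; yes; no; does; contradiction)
open import Relation.Nullary.Decidable using (_×-dec_; _→-dec_; dec-true)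
import Relation.Nullary.Decidable as Dec
open import Relation.Unary using (Decidable)

private variable
  A B : Set
  k n N : ℕ

-- Counting with lists: lengths, products and sums.

lookup-injective : {xs : List A} → Unique xs → ∀ {i j} → lookup xs i ≡ lookup xs j → i ≡ j
lookup-injective (_ ∷ _)   {zero}  {zero}  _  = refl
lookup-injective (x∉ ∷ _)  {zero}  {suc j} eq = contradiction eq (All.lookup x∉ (∈-lookup j))
lookup-injective (x∉ ∷ _)  {suc i} {zero}  eq =
  contradiction (≡.sym eq) (All.lookup x∉ (∈-lookup i))
lookup-injective (_ ∷ uxs) {suc i} {suc j} eq = cong suc (lookup-injective uxs eq)

-- `g` receives a membership proof because it may be definable on the entries only: in `weight≤` the
-- part assigned to a point depends on the point lying in the blow-up.
unique-length≤ : {xs : List A} → Unique xs → (g : ∀ {x} → x ∈ˡ xs → Fin n) →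
  (∀ {x y} (p : x ∈ˡ xs) (q : y ∈ˡ xs) → g p ≡ g q → x ≡ y) → length xs ≤ n
unique-length≤ uxs g g-inj =
  injective⇒≤ {f = λ i → g (∈-lookup i)} λ eq → lookup-injective uxs (g-inj _ _ eq)

unique-⊆-length≤ : {xs ys : List A} → Unique xs → xs List.⊆ ys → length xs ≤ length ys
unique-⊆-length≤ {ys = ys} uxs xs⊆ys = unique-length≤ uxs (λ p → index (xs⊆ys p)) λ p q eq →
  trans (lookup-index (xs⊆ys p))
    (trans (cong (lookup ys) eq) (≡.sym (lookup-index (xs⊆ys q))))

length-concatMap≤ : ∀ (f : A → List B) b → (∀ x → length (f x) ≤ b) →
  ∀ xs → length (concatMap f xs) ≤ length xs * b
length-concatMap≤ f b f≤b []       = z≤n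
length-concatMap≤ f b f≤b (x ∷ xs) = begin
  length (f x ++ concatMap f xs)         ≡⟨ length-++ (f x) ⟩
  length (f x) + length (concatMap f xs) ≤⟨ +-mono-≤ (f≤b x) (length-concatMap≤ f b f≤b xs) ⟩
  b + length xs * b                      ∎
  where open ≤-Reasoning

n≤2^n : ∀ n → n ≤ 2 ^ n
n≤2^n zero    = z≤n
n≤2^n (suc n) = begin
  1 + n             ≤⟨ +-mono-≤ (m^n>0 2 n) (n≤2^n n) ⟩
  2 ^ n + 2 ^ n     ≡⟨ cong (2 ^ n +_) (≡.sym (+-identityʳ (2 ^ n))) ⟩
  2 ^ suc n         ∎
  where open ≤-Reasoning

-- Apply `n≤2^n` to every factor; the exponents then add up to the length of the concatenation. This
-- turns a bound on the vertices over all centres into one on the number of copies.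
product-length≤ : ∀ {m} (F : Fin m → List A) →
  product (tabulate (length ∘ F)) ≤ 2 ^ length (concat (tabulate F))
product-length≤ {m = zero}  F = ≤-refl
product-length≤ {m = suc m} F = begin
  length (F zero) * product (tabulate (length ∘ F ∘ suc))
    ≤⟨ *-mono-≤ (n≤2^n (length (F zero))) (product-length≤ (F ∘ suc)) ⟩
  2 ^ length (F zero) * 2 ^ length rest  ≡⟨ ^-distribˡ-+-* 2 (length (F zero)) (length rest) ⟨
  2 ^ (length (F zero) + length rest)    ≡⟨ cong (2 ^_) (length-++ (F zero)) ⟨
  2 ^ length (F zero ++ rest)            ∎
  where
  open ≤-Reasoning
  rest = concat (tabulate (F ∘ suc))

sum-map≤ : ∀ (f : A → ℕ) b xs → (∀ {x} → x ∈ˡ xs → f x ≤ b) → sum (map f xs) ≤ length xs * b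
sum-map≤ f b []       f≤b = z≤n
sum-map≤ f b (x ∷ xs) f≤b = +-mono-≤ (f≤b (here refl)) (sum-map≤ f b xs (f≤b ∘ there))

sum-pigeonhole : ∀ (f : A → ℕ) b xs → sum (map f xs) < length xs * b → ∃ λ x → f x < b
sum-pigeonhole f b (x ∷ xs) lt with f x <? b
... | yes fx<b = x , fx<b
... | no  fx≮b = sum-pigeonhole f b xs (≰⇒> λ ge → <⇒≱ lt (+-mono-≤ (≮⇒≥ fx≮b) ge))

-- Double counting and boxes in a cube.

module _ {R : A → B → Set} (R? : ∀ x → Decidable (R x)) (w : A → ℕ) where

  private
    column : List A → B → ℕ
    column xs b = sum (map w (filter (λ x → R? x b) xs))

    split : ∀ x xs bs → sum (map (column (x ∷ xs)) bs) ≡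
                        length (filter (R? x) bs) * w x + sum (map (column xs) bs)
    split x xs []       = refl
    split x xs (b ∷ bs) with does (R? x b)
    ... | false = trans (cong (column xs b +_) (split x xs bs))
      (x∙yz≈y∙xz (column xs b) (length (filter (R? x) bs) * w x) (sum (map (column xs) bs)))
    ... | true  = trans (cong (w x + column xs b +_) (split x xs bs))
      (interchange (w x) (column xs b) (length (filter (R? x) bs) * w x) (sum (map (column xs) bs)))

  -- Both sides add `w x` over the related pairs `(x , b)`; the induction on `xs` uses `split` to
  -- detach the contribution of one row from all columns. For boxes, `b` is a first coordinate and
  -- `w` the size of the box in the remaining ones.
  weighted-double-count : ∀ xs bs →
    sum (map (λ x → length (filter (R? x) bs) * w x) xs) ≡
    sum (map (λ b → sum (map w (filter (λ x → R? x b) xs))) bs)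
  weighted-double-count []       bs = ≡.sym (zeros bs)
    where
    zeros : ∀ bs → sum (map (column []) bs) ≡ 0
    zeros []       = refl
    zeros (_ ∷ bs) = zeros bs
  weighted-double-count (x ∷ xs) bs =
    trans (cong (length (filter (R? x) bs) * w x +_) (weighted-double-count xs bs))
          (≡.sym (split x xs bs))

-- If the boxes ∏ᵢ {a | P x i a}, x ∈ xs, have fewer than K^m points in total, they miss a point of
-- the cube: fix its coordinates one by one, keeping the remaining boxes too small to cover the rest.
boxes-miss-point : ∀ m {K} {P : A → Fin m → Fin K → Set} (P? : ∀ x i → Decidable (P x i)) xs →
  sum (map (λ x → product (tabulate λ i → length (filter (P? x i) (allFin K)))) xs) < K ^ m →
  ∃ λ (p : Fin m → Fin K) → ∀ {x} → x ∈ˡ xs → ¬ (∀ i → P x i (p i))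
boxes-miss-point zero    P? []       lt = (λ ()) , λ ()
-- In dimension zero a box is an empty product, of size 1, so a total below `K ^ 0 = 1` rules out
-- every box.
boxes-miss-point zero    P? (x ∷ xs) (s≤s ())
boxes-miss-point (suc m) {K} P? xs lt =
  let
    size  = λ x → product (tabulate λ i → length (filter (P? x (suc i)) (allFin K)))
    count = weighted-double-count (λ x → P? x zero) size xs (allFin K)
    a , a-light = sum-pigeonhole _ (K ^ m) (allFin K)
      (subst₂ _<_ count (cong (_* K ^ m) (≡.sym (length-tabulate {n = K} id))) lt)
    p , p-missed = boxes-miss-point m (λ x i → P? x (suc i)) (filter (λ x → P? x zero a) xs) a-light
  in (λ { zero → a ; (suc i) → p i }) , λ x∈xs inside →
     p-missed (∈-filter⁺ (λ x → P? x zero a) x∈xs (inside zero)) (inside ∘ suc)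

-- Neighbourhoods and degrees.

neighbours : Graph n → Fin n → List (Fin n)
neighbours {n} G u = filter (λ v → adj G u v Bool.≟ true) (allFin n)

∈-neighbours⁺ : (G : Graph n) → ∀ {u v} → adj G u v ≡ true → v ∈ˡ neighbours G u
∈-neighbours⁺ G {u} {v} = ∈-filter⁺ (λ v → adj G u v Bool.≟ true) (∈-allFin v)

∈-neighbours⁻ : (G : Graph n) → ∀ {u v} → v ∈ˡ neighbours G u → adj G u v ≡ true
∈-neighbours⁻ {n} G {u} = proj₂ ∘ ∈-filter⁻ (λ v → adj G u v Bool.≟ true) {xs = allFin n}

sum-indicator : ∀ (p : A → Bool) xs →
  sum (map (λ x → if p x then 1 else 0) xs) ≡ length (filter (λ x → p x Bool.≟ true) xs)
sum-indicator p []       = refl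
sum-indicator p (x ∷ xs) with p x
... | true  = cong suc (sum-indicator p xs)
... | false = sum-indicator p xs

deg≡length-neighbours : (G : Graph n) → ∀ u → deg G u ≡ length (neighbours G u)
deg≡length-neighbours {n} G u = sum-indicator (adj G u) (allFin n)

adj-sym : (G : Graph n) → ∀ {u v} → adj G u v ≡ true → adj G v u ≡ true
adj-sym G {u} {v} = trans (sym G v u)

-- Take the first edge of a path from `u` to a different vertex; `punchIn u zero` is such a vertex.
connected⇒neighbour : 2 ≤ n → (G : Graph n) → Connected G → ∀ u → ∃ λ v → adj G u v ≡ true
connected⇒neighbour (s≤s (s≤s _)) G conn u with punchIn u zero in eq | conn u (punchIn u zero)
... | _ | here      = contradiction eq (punchInᵢ≢i u zero)
... | _ | step e _  = _ , e

-- Extending blow-ups to maximal ones.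

module _ (H : Graph k) (G : Graph n) where

  private
    Valid : Subset n → (Fin n → Fin k) → Set
    Valid S f = (∀ i → ∃ λ v → v ∈ S × f v ≡ i) ×
      (∀ u v → u ∈ S → v ∈ S → adj H (f u) (f v) ≡ true → adj G u v ≡ true)

    valid? : ∀ S → Decidable (Valid S)
    valid? S f =
      all? (λ i → any? λ v → v ∈? S ×-dec f v ≟ i) ×-dec
      all? (λ u → all? λ v → u ∈? S →-dec v ∈? S →-dec
        (adj H (f u) (f v) Bool.≟ true) →-dec (adj G u v Bool.≟ true))

    -- Decoding the code of `f` gives back `f` only pointwise, so validity has to be carried along
    -- pointwise equality.
    valid-resp : ∀ {S f g} → (∀ x → g x ≡ f x) → Valid S f → Valid S g
    valid-resp g≗f (onto , complete) =
      (λ i → let v , v∈S , fv≡i = onto i in v , v∈S , trans (g≗f v) fv≡i) ,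
      λ u v u∈S v∈S e → complete u v u∈S v∈S
        (subst (_≡ true) (cong₂ (adj H) (g≗f u) (g≗f v)) e)

  -- The part maps are finitely many: search their codes. Decidability lets the search for a larger
  -- blow-up terminate with a definite answer.
  isBlowup? : Decidable (IsBlowup H G)
  isBlowup? S = Dec.map′
    (λ (c , valid) → finToFun c , valid)
    (λ (f , valid) → funToFin f , valid-resp (finToFun-funToFin f) valid)
    (any? λ c → valid? S (finToFun c))

  -- Pass to a strictly larger blow-up as long as there is one; strict inclusion of subsets of a
  -- finite set makes this stop.
  maximal-extension : ∀ {S} → IsBlowup H G S → ∃ λ S' → S ⊆ S' × IsMaximalBlowup H G S'
  maximal-extension {S} = extend (⊃-wellFounded S)
    where
    extend : ∀ {S} → Acc _⊃_ S → IsBlowup H G S → ∃ λ S' → S ⊆ S' × IsMaximalBlowup H G S'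
    extend {S} (acc rec) blowup with anySubset? (λ S' → S ⊂? S' ×-dec isBlowup? S')
    ... | no  maximal           = S , ⊆-refl , blowup , λ S' S⊂S' b → maximal (S' , S⊂S' , b)
    ... | yes (S' , S⊂S' , b) =
      let S″ , S'⊆S″ , max = extend (rec S⊂S') b
      in S″ , ⊆-trans (proj₁ S⊂S') S'⊆S″ , max

-- Packing closed neighbourhoods.

module Packing (H : Graph N) where

  open DecMembership (_≟_ {N}) using () renaming (_∈?_ to _∈ˡ?_)

  N[_] : Fin N → List (Fin N)
  N[ u ] = u ∷ neighbours H u

  N[]-sym : ∀ {u v} → v ∈ˡ N[ u ] → u ∈ˡ N[ v ]
  N[]-sym (here refl) = here refl
  N[]-sym (there v∈)  = there (∈-neighbours⁺ H (adj-sym H (∈-neighbours⁻ H v∈)))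

  Meets : Fin N → Fin N → Set
  Meets u v = Any (_∈ˡ N[ v ]) N[ u ]

  meets : ∀ {u v w} → w ∈ˡ N[ u ] → w ∈ˡ N[ v ] → Meets u v
  meets w∈u w∈v = Any.map (λ { refl → w∈v }) w∈u

  disjoint-closed-neighbourhoods : ∀ {cs} → AllPairs (λ u v → ¬ Meets u v) cs →
    ∀ i j {w} → w ∈ˡ N[ lookup cs i ] → w ∈ˡ N[ lookup cs j ] → i ≡ j
  disjoint-closed-neighbourhoods (_ ∷ _)    zero    zero    _   _   = refl
  disjoint-closed-neighbourhoods (far ∷ _)  zero    (suc j) w∈i w∈j =
    contradiction (meets w∈i w∈j) (All.lookup far (∈-lookup j))
  disjoint-closed-neighbourhoods (far ∷ _)  (suc i) zero    w∈i w∈j =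
    contradiction (meets w∈j w∈i) (All.lookup far (∈-lookup i))
  disjoint-closed-neighbourhoods (_ ∷ fars) (suc i) (suc j) w∈i w∈j =
    cong suc (disjoint-closed-neighbourhoods fars i j w∈i w∈j)

  -- A vertex is chosen unless it meets one chosen before. The last component records maximality: a
  -- rejected vertex meets an earlier centre, a chosen one meets itself.
  greedy : ∀ xs → ∃ λ cs → AllPairs (λ u v → ¬ Meets u v) cs × All (λ x → Any (Meets x) cs) xs
  greedy []       = [] , [] , []
  greedy (x ∷ xs) with greedy xs
  ... | cs , far , covered with Any.any? (λ c → Any.any? (_∈ˡ? N[ c ]) N[ x ]) cs
  ...   | yes x-meets = cs , far , x-meets ∷ covered
  ...   | no  x-far   =
    x ∷ cs , ¬Any⇒All¬ cs x-far ∷ far ,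
    here (meets (here refl) (here refl)) ∷ All.map there covered

  centres : List (Fin N)
  centres = proj₁ (greedy (allFin N))

  centres-disjoint : ∀ i j {w} →
    w ∈ˡ N[ lookup centres i ] → w ∈ˡ N[ lookup centres j ] → i ≡ j
  centres-disjoint = disjoint-closed-neighbourhoods (proj₁ (proj₂ (greedy (allFin N))))

  -- By maximality every vertex is within two steps of a centre, and two steps, with staying put
  -- allowed, reach at most `suc d * suc d` vertices.
  order≤ : ∀ {d} → (∀ u → deg H u ≤ d) → N ≤ length centres * (suc d * suc d)
  order≤ {d} deg≤ = begin
    N                                ≡⟨ length-tabulate id ⟨
    length (allFin N)                ≤⟨ unique-⊆-length≤ (Unique.allFin⁺ N) (λ {x} _ → covered x) ⟩
    length (concatMap ball centres)  ≤⟨ length-concatMap≤ ball _ ball≤ centres ⟩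
    length centres * (suc d * suc d) ∎
    where
    open ≤-Reasoning
    ball : Fin N → List (Fin N)
    ball c = concatMap N[_] N[ c ]
    N[]≤ : ∀ u → length N[ u ] ≤ suc d
    N[]≤ u = s≤s (≤-trans (≤-reflexive (≡.sym (deg≡length-neighbours H u))) (deg≤ u))
    ball≤ : ∀ c → length (ball c) ≤ suc d * suc d
    ball≤ c = ≤-trans (length-concatMap≤ N[_] (suc d) N[]≤ N[ c ]) (*-monoˡ-≤ (suc d) (N[]≤ c))
    x∈ball : ∀ {x c} → Meets x c → x ∈ˡ ball c
    x∈ball x-meets-c with lookup-index x-meets-c
    -- The common element `w` of both closed neighbourhoods is the intermediate stop: it lies in
    -- `N[ c ]`, and `x` lies in `N[ w ]` by symmetry.
    ... | w∈c = ∈-concatMap⁺ N[_] (Any.map (λ { refl → N[]-sym (∈-lookup (index x-meets-c)) }) w∈c)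
    covered : ∀ x → x ∈ˡ concatMap ball centres
    covered x = ∈-concatMap⁺ ball
      (Any.map x∈ball (All.lookup (proj₂ (proj₂ (greedy (allFin N)))) (∈-allFin x)))

-- The layered graph.

module Layered (H : Graph N) (K : ℕ) where

  open Packing H
  open DecMembership (_≟_ {N}) using () renaming (_∈?_ to _∈ˡ?_)

  m : ℕ
  m = length centres

  c : Fin m → Fin N
  c = lookup centres

  isCentre? : ∀ u → Dec (∃ λ i → c i ≡ u)
  isCentre? u = any? λ i → c i ≟ u

  site : Fin (N * K) → Fin N
  site = proj₁ ∘ remQuot K

  layer : Fin (N * K) → Fin K
  layer = proj₂ ∘ remQuot {N} K

  sameLayer : Fin (N * K) → Fin (N * K) → Bool
  sameLayer x y = does (layer x ≟ layer y)

  offCentre : Fin (N * K) → Bool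
  offCentre x = not (does (isCentre? (site x)))

  G : Graph (N * K)
  G .adj x y = adj H (site x) (site y) ∧ (sameLayer x y ∨ (offCentre x ∧ offCentre y))
  G .sym x y = cong₂ _∧_ (sym H (site x) (site y))
    (cong₂ _∨_ (Dec.does-⇔ (mk⇔ ≡.sym ≡.sym) (layer x ≟ layer y) (layer y ≟ layer x))
      (Bool.∧-comm (offCentre x) (offCentre y)))
  G .irrefl x = cong (_∧ (sameLayer x x ∨ (offCentre x ∧ offCentre x))) (irrefl H (site x))

  deg-G≤ : ∀ {d} → (∀ u → deg H u ≤ d) → ∀ x → deg G x ≤ d * K
  deg-G≤ {d} deg≤ x = begin
    deg G x                                        ≡⟨ deg≡length-neighbours G x ⟩
    length (neighbours G x)                        ≤⟨ unique-⊆-length≤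
                                                       (Unique.filter⁺ _ (Unique.allFin⁺ _)) ⊆fibres ⟩
    length (concatMap fibre (neighbours H (site x))) ≤⟨ length-concatMap≤ fibre K fibre≤ (neighbours H (site x)) ⟩
    length (neighbours H (site x)) * K             ≡⟨ cong (_* K) (deg≡length-neighbours H (site x)) ⟨
    deg H (site x) * K                             ≤⟨ *-monoˡ-≤ K (deg≤ (site x)) ⟩
    d * K                                          ∎
    where
    open ≤-Reasoning
    fibre : Fin N → List (Fin (N * K))
    fibre v = map (combine v) (allFin K)
    fibre≤ : ∀ v → length (fibre v) ≤ K
    fibre≤ v = ≤-reflexive (trans (length-map (combine v) (allFin K)) (length-tabulate id))
    ⊆fibres : neighbours G x List.⊆ concatMap fibre (neighbours H (site x))
    ⊆fibres {y} y∈ = ∈-concatMap⁺ fibre (Any.map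
      (λ { refl → subst (_∈ˡ fibre (site y)) (combine-remQuot {N} K y)
                        (∈-map⁺ (combine (site y)) (∈-allFin (layer y))) })
      (∈-neighbours⁺ H (Bool.∧-conicalˡ _ _ (∈-neighbours⁻ G y∈))))

  site-c : ∀ i a → site (combine (c i) a) ≡ c i
  site-c i a = cong proj₁ (remQuot-combine (c i) a)

  layer-c : ∀ i a → layer (combine (c i) a) ≡ a
  layer-c i a = cong proj₂ (remQuot-combine (c i) a)

  -- An edge with an end over a centre cannot come from the off-centre clause, so it stays in its
  -- layer. Since closed neighbourhoods of centres are disjoint, `y` then determines both `i` and
  -- `a`.
  adj-over-centre : ∀ i a {y} → adj G (combine (c i) a) y ≡ true →
    site y ∈ˡ N[ c i ] × layer y ≡ a
  adj-over-centre i a {y} e =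
    there (∈-neighbours⁺ H (subst (λ u → adj H u (site y) ≡ true) (site-c i a)
      (Bool.∧-conicalˡ _ _ e))) ,
    same
    where
    same : layer y ≡ a
    same with layer (combine (c i) a) ≟ layer y | isCentre? (site (combine (c i) a))
              | Bool.∧-conicalʳ (adj H (site (combine (c i) a)) (site y)) _ e
    ... | yes eq | _ | _ = trans (≡.sym eq) (layer-c i a)
    ... | no _ | no ¬centre | _ = contradiction (i , ≡.sym (site-c i a)) ¬centre

  -- Copies of `H` from labels on the centres.

  module _ (k₀ : Fin K) (p : Fin m → Fin K) where

    label : Fin N → Fin K
    label u with any? (λ i → u ∈ˡ? N[ c i ])
    ... | yes (i , _) = p i
    -- Any layer will do: such a vertex is neither a centre nor adjacent to one, so its edges in `H`
    -- lift to all pairs of layers.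
    ... | no  _       = k₀

    label-near : ∀ i {u} → u ∈ˡ N[ c i ] → label u ≡ p i
    label-near i {u} u∈ with any? (λ i → u ∈ˡ? N[ c i ])
    ... | yes (j , u∈j) = cong p (centres-disjoint j i u∈j u∈)
    ... | no  none      = contradiction (i , u∈) none

    copy : Subset (N * K)
    copy = Vec.tabulate λ x → does (layer x ≟ label (site x))

    ∈-copy⁻ : ∀ {x} → x ∈ copy → layer x ≡ label (site x)
    ∈-copy⁻ {x} x∈ with layer x ≟ label (site x)
                      | trans (≡.sym (lookup∘tabulate _ x)) ([]=⇒lookup x∈)
    ... | yes eq | _ = eq

    ∈-copy⁺ : ∀ {x} → layer x ≡ label (site x) → x ∈ copy
    ∈-copy⁺ {x} eq = lookup⇒[]= x copy
      (trans (lookup∘tabulate _ x) (dec-true (layer x ≟ label (site x)) eq))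

    combine∈copy : ∀ u {a} → a ≡ label u → combine u a ∈ copy
    combine∈copy u {a} eq = ∈-copy⁺ (trans (cong proj₂ (remQuot-combine u a))
      (trans eq (cong (label ∘ proj₁) (≡.sym (remQuot-combine u a)))))

    centre∈copy : ∀ i → combine (c i) (p i) ∈ copy
    centre∈copy i = combine∈copy (c i) (≡.sym (label-near i (here refl)))

    -- An edge of `H` at a centre lies inside one closed neighbourhood, where `label` is constant,
    -- so its ends share a layer; every other edge is present between any two layers.
    copy-isBlowup : IsBlowup H G copy
    copy-isBlowup = site ,
      (λ u → combine u (label u) , combine∈copy u refl , cong proj₁ (remQuot-combine u (label u))) ,
      λ x y x∈ y∈ e → cong₂ _∧_ e (linked x y (∈-copy⁻ x∈) (∈-copy⁻ y∈) e)
      where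
      label-const : ∀ {u v} i → c i ≡ u → adj H u v ≡ true → label u ≡ label v
      label-const i refl e =
        trans (label-near i (here refl)) (≡.sym (label-near i (there (∈-neighbours⁺ H e))))
      linked : ∀ x y → layer x ≡ label (site x) → layer y ≡ label (site y) →
        adj H (site x) (site y) ≡ true → sameLayer x y ∨ (offCentre x ∧ offCentre y) ≡ true
      linked x y lx ly e with layer x ≟ layer y | isCentre? (site x) | isCentre? (site y)
      ... | yes _   | _             | _             = refl
      ... | no _    | no _          | no _          = refl
      ... | no diff | yes (i , ci≡) | _             =
        contradiction (trans lx (trans (label-const i ci≡ e) (≡.sym ly))) diff
      ... | no diff | no _          | yes (i , ci≡) =
        contradiction (trans lx (trans (≡.sym (label-const i ci≡ (adj-sym H e))) (≡.sym ly))) diff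

  -- Counting copies and maximal blow-ups.

  over? : ∀ (S : Subset (N * K)) i → Decidable λ a → combine (c i) a ∈ S
  over? S i a = combine (c i) a ∈? S

  -- The number of labellings `p` whose chosen vertices over the centres all lie in `S`, that is,
  -- the size of the box of `S`. It bounds how many labellings have their copy inside `S`.
  weight : Subset (N * K) → ℕ
  weight S = product (tabulate λ i → length (filter (over? S i) (allFin K)))

  -- Each vertex over a centre is sent to a part of S it is completely joined to; a representative of
  -- that part determines both the centre and the layer.
  weight≤ : (∀ u → ∃ λ v → adj H u v ≡ true) → ∀ {S} → IsBlowup H G S → weight S ≤ 2 ^ N
  weight≤ nbr {S} (f , onto , complete) = begin
    weight S                            ≡⟨ cong product (tabulate-cong λ i →
                                             ≡.sym (length-map (i ,_) (filter (over? S i) (allFin K)))) ⟩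
    product (tabulate (length ∘ block)) ≤⟨ product-length≤ block ⟩
    2 ^ length points                   ≤⟨ ^-monoʳ-≤ 2 (unique-length≤ points-unique
                                             (λ q → part (over q)) part-injective) ⟩
    2 ^ N                               ∎
    where
    open ≤-Reasoning
    block : Fin m → List (Fin m × Fin K)
    block i = map (i ,_) (filter (over? S i) (allFin K))
    points : List (Fin m × Fin K)
    points = concat (tabulate block)
    ∈-block : ∀ {i x} → x ∈ˡ block i → proj₁ x ≡ i × combine (c i) (proj₂ x) ∈ S
    ∈-block {i} x∈ with ∈-map⁻ (i ,_) x∈
    ... | a , a∈ , refl = refl , proj₂ (∈-filter⁻ (over? S i) {xs = allFin K} a∈)
    points-unique : Unique points
    points-unique = Unique.concat⁺
      (All-tabulate⁺ λ i → Unique.map⁺ (cong proj₂)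
        (Unique.filter⁺ (over? S i) (Unique.allFin⁺ K)))
      (AllPairs.tabulate⁺ λ i≢j (x∈i , x∈j) →
        i≢j (trans (≡.sym (proj₁ (∈-block x∈i))) (proj₁ (∈-block x∈j))))
    over : ∀ {x} → x ∈ˡ points → combine (c (proj₁ x)) (proj₂ x) ∈ S
    over x∈ with Any-tabulate⁻ (concat⁻ (tabulate block) x∈)
    ... | i , x∈i with ∈-block x∈i
    ...   | refl , ∈S = ∈S
    part : ∀ {v} → v ∈ S → Fin N
    part {v} _ = proj₁ (nbr (f v))
    joined : ∀ {v} (v∈S : v ∈ S) → adj G v (proj₁ (onto (part v∈S))) ≡ true
    joined {v} v∈S = let t , t∈S , ft≡ = onto (part v∈S) in
      complete v t v∈S t∈S (subst (λ j → adj H (f v) j ≡ true) (≡.sym ft≡) (proj₂ (nbr (f v))))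
    part-injective : ∀ {x y} (q : x ∈ˡ points) (r : y ∈ˡ points) →
      part (over q) ≡ part (over r) → x ≡ y
    part-injective {i , a} {j , b} q r eq =
      let near-i , layer≡a = adj-over-centre i a (joined (over q))
          near-j , layer≡b = adj-over-centre j b
            (subst (λ l → adj G (combine (c j) b) (proj₁ (onto l)) ≡ true) (≡.sym eq)
              (joined (over r)))
      in cong₂ _,_ (centres-disjoint i j near-i near-j) (trans (≡.sym layer≡a) layer≡b)

  -- With fewer than `2 ^ N` sets listed, their boxes are too small to cover the cube of labellings.
  -- A missed labelling gives a copy inside no listed set, and a maximal extension of that copy is
  -- new.
  many-maximal-blowups : Fin K → (∀ u → ∃ λ v → adj H u v ≡ true) → 2 ^ N * 2 ^ N ≤ K ^ m →
    ∀ n → n ≤ 2 ^ N → ∃ λ L → Unique L × All (IsMaximalBlowup H G) L × length L ≡ n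
  many-maximal-blowups k₀ nbr K^m≥ zero    _  = [] , [] , [] , refl
  many-maximal-blowups k₀ nbr K^m≥ (suc n) n< =
    let
      L , L-unique , L-max , L-length = many-maximal-blowups k₀ nbr K^m≥ n (<⇒≤ n<)
      p , p-missed = boxes-miss-point m over? L (begin-strict
        sum (map weight L)   ≤⟨ sum-map≤ weight (2 ^ N) L (λ S∈L →
                                  weight≤ nbr (proj₁ (All.lookup L-max S∈L))) ⟩
        length L * 2 ^ N     ≡⟨ cong (_* 2 ^ N) L-length ⟩
        n * 2 ^ N            <⟨ *-monoˡ-< (2 ^ N) {{m^n≢0 2 N}} n< ⟩
        2 ^ N * 2 ^ N        ≤⟨ K^m≥ ⟩
        K ^ m                ∎)
      S , copy⊆S , S-max = maximal-extension H G (copy-isBlowup k₀ p)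
      -- If `S` equalled a listed `T`, then `T` would contain the vertices of the copy over all
      -- centres, putting `p` in the box of `T`.
      S-new = λ {T} (T∈L : T ∈ˡ L) (S≡T : S ≡ T) → p-missed T∈L λ i →
        subst (combine (c i) (p i) ∈_) S≡T (copy⊆S (centre∈copy k₀ p i))
    in S ∷ L , All.tabulate S-new ∷ L-unique , S-max ∷ L-max , cong suc L-length
    where open ≤-Reasoning

-- Numerical bounds and conclusion.

2*[1+d]²≤d^[21d+20] : ∀ {d} → 2 ≤ d → 2 * (suc d * suc d) ≤ d ^ (21 * d + 20)
2*[1+d]²≤d^[21d+20] {d@(suc _)} 2≤d = begin
  -- The exponent 5 is 1 + 2 + 2: one from `2 ≤ d` and two from each use of `1+d≤d²`.
  2 * (suc d * suc d)          ≤⟨ *-mono-≤ 2≤d (*-mono-≤ 1+d≤d² 1+d≤d²) ⟩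
  d * ((d ^ 2) * (d ^ 2))      ≡⟨ cong (d *_) (^-distribˡ-+-* d 2 2) ⟨
  d ^ 5                        ≤⟨ ^-monoʳ-≤ d (≤-trans (m≤m+n 5 15) (m≤n+m 20 (21 * d))) ⟩
  d ^ (21 * d + 20)            ∎
  where
  open ≤-Reasoning
  1+d≤d² : suc d ≤ d ^ 2
  1+d≤d² = begin
    1 + d       ≤⟨ +-monoˡ-≤ d (s≤s z≤n) ⟩
    d + d       ≡⟨ cong (d +_) (+-identityʳ d) ⟨
    2 * d       ≤⟨ *-monoˡ-≤ d 2≤d ⟩
    d * d       ≡⟨ cong (d *_) (*-identityʳ d) ⟨
    d ^ 2       ∎

layered-many : ∀ {d κ} → 2 * (suc d * suc d) ≤ κ → 2 ≤ N → (H : Graph N) → Connected H →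
  (∀ v → deg H v ≤ d) → ManyMaxBlowups H (Layered.G H (2 ^ κ)) (2 ^ κ)
layered-many {N = N} {d = d} {κ = κ} κ≥ 2≤N H conn deg≤ =
  let L , L-unique , L-max , L-length =
        many-maximal-blowups (fromℕ< (m^n>0 2 κ)) (connected⇒neighbour 2≤N H conn) K^m≥ (2 ^ N) ≤-refl
  -- With `2 ^ N` sets the encoded root condition is an equality: raised to the power `2 ^ κ`, this
  -- count is 2 to the number of vertices, `N * 2 ^ κ`.
  in 2 ^ N , (L , L-unique , L-max , ≤-reflexive (≡.sym L-length)) ,
     ≤-reflexive (≡.sym (^-*-assoc 2 N (2 ^ κ)))
  where
  open Layered H (2 ^ κ)
  open ≤-Reasoning
  D = suc d * suc d
  N+N≤κm : N + N ≤ κ * m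
  N+N≤κm = begin
    N + N         ≡⟨ cong (N +_) (+-identityʳ N) ⟨
    2 * N         ≤⟨ *-monoʳ-≤ 2 (Packing.order≤ H deg≤) ⟩
    2 * (m * D)   ≡⟨ cong (2 *_) (*-comm m D) ⟩
    2 * (D * m)   ≡⟨ *-assoc 2 D m ⟨
    2 * D * m     ≤⟨ *-monoˡ-≤ m κ≥ ⟩
    κ * m         ∎
  K^m≥ : 2 ^ N * 2 ^ N ≤ (2 ^ κ) ^ m
  K^m≥ = begin
    2 ^ N * 2 ^ N ≡⟨ ^-distribˡ-+-* 2 N N ⟨
    2 ^ (N + N)   ≤⟨ ^-monoʳ-≤ 2 N+N≤κm ⟩
    2 ^ (κ * m)   ≡⟨ ^-*-assoc 2 κ m ⟨
    (2 ^ κ) ^ m   ∎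

theorem6 : (d : ℕ) → 2 ≤ d → (N : ℕ) → (H : Graph N) → Connected H → MaxDegree H d →
    d ^ (d ^ (d ^ d)) < N →
    Σ ℕ λ n → Σ (Graph n) λ G →
    (N ≤ n) × (n ≤ 2 ^ (d ^ (21 * d + 20)) * N) ×
    (∀ v → deg G v ≤ d * 2 ^ (d ^ (21 * d + 20))) ×
    ManyMaxBlowups H G (2 ^ (d ^ (21 * d + 20)))
theorem6 d@(suc _) 2≤d N H conn (deg≤ , _) N-large =
  N * K , Layered.G H K , m≤m*n N K {{m^n≢0 2 (d ^ (21 * d + 20))}} , ≤-reflexive (*-comm N K) ,
  Layered.deg-G≤ H K deg≤ ,
  layered-many (2*[1+d]²≤d^[21d+20] 2≤d) 2≤N H conn deg≤
  where
  K = 2 ^ (d ^ (21 * d + 20))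
  -- The tower is at least 1, so `N` exceeds 1; with connectedness this gives every vertex a
  -- neighbour.
  2≤N : 2 ≤ N
  2≤N = ≤-trans (s≤s (m^n>0 d (d ^ (d ^ d)))) N-large
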